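{- Let $J_0$ and $J_1$ be two pairs of twin binary trees with $n$ nodes. Then $$J_0 \leq_{\mathrm{B}} J_1 \quad\text{if and only if}\quad \omega(\mathrm{ttd}(J_0))_i \leq \omega(\mathrm{ttd}(J_1))_i \ \text{ for all } 1 \leq i \leq n.$$
   Context: A binary tree is either a leaf (empty tree) or a node with a left and a right binary subtree. The canopy of a binary tree with $n$ nodes is the word of length $n-1$ on $\{0,1\}$ obtained by reading its leaves from left to right except the first and the last one, writing $0$ if the leaf is a right child and $1$ if it is a left child. A pair of twin binary trees with $n$ nodes is a pair $(T_L,T_R)$ of binary trees with $n$ nodes each whose canopies differ at every position $1 \leq i \leq n-1$. The Tamari diagram $\mathrm{td}(T)$ of a binary tree $T$ with $n$ nodes is the word of length $n$ whose $i$-th letter is the number of nodes in the right subtree of the $i$-th node of $T$ in inorder (left subtree, root, right subtree). For a pair of twin binary trees $J=(T_L,T_R)$, $\mathrm{ttd}(J) = (\mathrm{td}(T_L),\mathrm{td}(T_R))$; for $\delta = (\delta^L,\delta^R)$ of this form, $\omega(\delta)$ is the sequence of integers defined by $\omega(\delta)_i = -\delta^L_i$ if $\delta^L_i \neq 0$ and $\omega(\delta)_i = \delta^R_i$ otherwise, for $1 \leq i \leq n$. For a permutation $\sigma$ of $\{1,\dots,n\}$ (seen as a word), $\mathsf{P}(\sigma) = (T_L,T_R)$ where $T_L$ (resp. $T_R$) is the shape (labels forgotten) of the binary search tree obtained by inserting the letters of $\sigma$ from left to right (resp. from right to left) with the standard binary search tree leaf insertion (smaller letters go left, larger letters go right).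 This is a pair of twin binary trees. The permutohedron order $\leq_{\mathrm{P}}$ on permutations of size $n$ is the partial order in which $\sigma$ is covered by $\nu$ iff $\sigma = u\,ab\,v$ and $\nu = u\,ba\,v$ for some words $u,v$ and letters $a<b$. The Baxter order $\leq_{\mathrm{B}}$ on pairs of twin binary trees with $n$ nodes is defined by: $J_0 \leq_{\mathrm{B}} J_1$ iff there are permutations $\sigma, \nu$ of size $n$ with $\sigma \leq_{\mathrm{P}} \nu$, $\mathsf{P}(\sigma) = J_0$ and $\mathsf{P}(\nu) = J_1$. -}

module Defs where

open import Data.Fin.Base using (Fin)
open import Data.Fin.Patterns using (0F; 1F)
open import Data.Integer.Base using (ℤ; +_; -_)
open import Data.List.Base using
  (List; []; _∷_; [_]; _++_; length; drop; take; applyUpTo; foldl; foldr; zipWith)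
open import Data.List.Relation.Binary.Permutation.Propositional using (_↭_)
open import Data.List.Relation.Binary.Pointwise using (Pointwise)
open import Data.Nat.Base using (ℕ; zero; suc; _∸_; _<_)
open import Data.Nat.Properties using (_<?_)
open import Data.Product.Base using (_×_; _,_; ∃₂)
open import Data.Tree.Binary using (Tree; leaf; node; #nodes; map)
open import Data.Unit.Base using (⊤; tt)
open import Function.Base using (const; flip; id)
open import Relation.Binary.Construct.Closure.ReflexiveTransitive using (Star)
open import Relation.Binary.PropositionalEquality.Core using (_≡_; _≢_)
open import Relation.Nullary.Decidable.Core using (yes; no)

BinaryTree : Set
BinaryTree = Tree ⊤ ⊤

-- The first argument is the letter to use when the whole tree is a single leaf:
-- it is 1 below a left edge and 0 below a right edge.
leafWord : Fin 2 → BinaryTree → List (Fin 2)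
leafWord c (leaf _)     = [ c ]
leafWord c (node l _ r) = leafWord 1F l ++ leafWord 0F r

dropEnds : {A : Set} → List A → List A
dropEnds xs = drop 1 (take (length xs ∸ 1) xs)

-- The initial letter 0F is arbitrary: it only occurs in the word of the empty
-- tree, where dropEnds discards it.
canopy : BinaryTree → List (Fin 2)
canopy t = dropEnds (leafWord 0F t)

record TwinBinaryTrees (n : ℕ) : Set where
  field
    left            : BinaryTree
    right           : BinaryTree
    left-size       : #nodes left ≡ n
    right-size      : #nodes right ≡ n
    canopies-differ : Pointwise _≢_ (canopy left) (canopy right)

  trees : BinaryTree × BinaryTree
  trees = left , right

td : BinaryTree → List ℕ
td (leaf _)     = []
td (node l _ r) = td l ++ #nodes r ∷ td r

ttd : ∀ {n} → TwinBinaryTrees n → List ℕ × List ℕ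
ttd J = td left , td right
  where open TwinBinaryTrees J

ω-letter : ℕ → ℕ → ℤ
ω-letter zero      r = + r
ω-letter l@(suc _) r = - (+ l)

ω : List ℕ × List ℕ → List ℤ
ω (δᴸ , δᴿ) = zipWith ω-letter δᴸ δᴿ

IsPermutation : ℕ → List ℕ → Set
IsPermutation n w = w ↭ applyUpTo suc n

-- Sending equal letters to the right is immaterial here: words are only
-- inserted when they are permutations.
insert : ℕ → Tree ℕ ⊤ → Tree ℕ ⊤
insert x (leaf _) = node (leaf tt) x (leaf tt)
insert x (node l y r) with x <? y
... | yes _ = node (insert x l) y r
... | no  _ = node l y (insert x r)

shape : Tree ℕ ⊤ → BinaryTree
shape = map (const tt) id

P : List ℕ → BinaryTree × BinaryTree
P w = shape (foldl (flip insert) (leaf tt) w) , shape (foldr insert (leaf tt) w)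

infix 4 _⋖P_ _≤P_ _≤B_

data _⋖P_ : List ℕ → List ℕ → Set where
  swap : ∀ u {a b} v → a < b → u ++ a ∷ b ∷ v ⋖P u ++ b ∷ a ∷ v

-- A chain of covers starting at a permutation of size n stays among the
-- permutations of size n, so the closure can be taken on all words.
_≤P_ : List ℕ → List ℕ → Set
_≤P_ = Star _⋖P_

_≤B_ : ∀ {n} → TwinBinaryTrees n → TwinBinaryTrees n → Set
_≤B_ {n} J₀ J₁ = ∃₂ λ σ ν →
  IsPermutation n σ × IsPermutation n ν × σ ≤P ν ×
  P σ ≡ TwinBinaryTrees.trees J₀ × P ν ≡ TwinBinaryTrees.trees J₁

{-# OPTIONS --safe #-}
module Submission where

open import Defs
open import Data.Integer.Base using (_≤_)
open import Data.List.Relation.Binary.Pointwise using (Pointwise)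
open import Data.Nat.Base using (ℕ)
open import Function.Bundles using (_⇔_)

open import Data.Empty using (⊥; ⊥-elim)
open import Data.Fin.Base using (Fin)
open import Data.Fin.Patterns using (0F; 1F)
open import Data.Integer.Base using (+≤+; -≤+; -≤-)
open import Data.List.Base
  using (List; []; _∷_; _++_; length; reverse; filter; foldl; foldr; map; take; applyUpTo; zipWith)
open import Data.List.Membership.Propositional using (_∈_; _∉_)
open import Data.List.Membership.Propositional.Properties
  using (∈-++⁺ˡ; ∈-++⁺ʳ; ∈-++⁻; ∈-∃++; ∈-filter⁺; ∈-filter⁻; ∈-applyUpTo⁺; ∈-applyUpTo⁻)
open import Data.List.Membership.Propositional.Properties.WithK using (unique∧set⇒bag)
open import Data.List.Properties
  using (length-++; length-map; map-++; reverse-foldl; filter-accept; filter-reject)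
open import Data.List.Relation.Binary.BagAndSetEquality using (∼bag⇒↭)
open import Data.List.Relation.Binary.Permutation.Propositional using (_↭_; ↭-sym; ↭⇒↭ₛ)
open import Data.List.Relation.Binary.Permutation.Propositional.Properties
  using (shift; ∈-resp-↭; ↭-reverse)
import Data.List.Relation.Binary.Permutation.Setoid.Properties as Permutationₛ
open import Data.List.Relation.Binary.Pointwise using ([]; _∷_)
open import Data.List.Relation.Binary.Sublist.Propositional
  using (_⊆_; _∷_; _∷ʳ_; ⊆-refl; ⊆-trans; to∈; from∈)
import Data.List.Relation.Binary.Sublist.Propositional.Properties as Sublist
open import Data.List.Relation.Unary.All as All using ()
open import Data.List.Relation.Unary.AllPairs using ([]; _∷_)
open import Data.List.Relation.Unary.Any using (here; there)
open import Data.List.Relation.Unary.Unique.Propositional using (Unique)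
import Data.List.Relation.Unary.Unique.Propositional.Properties as Unique
open import Data.Nat.Base using (zero; suc; _+_; _∸_; _<_; z≤n; s≤s) renaming (_≤_ to _≤ⁿ_)
open import Data.Nat.Induction using (<-wellFounded)
open import Data.Nat.Properties as ℕ using (_<?_)
open import Data.Product.Base using (_×_; _,_; ∃; ∃₂; proj₁; proj₂)
open import Data.Sum.Base using (_⊎_; inj₁; inj₂)
open import Data.Tree.Binary using (Tree; leaf; node; #nodes)
open import Data.Unit.Base using (⊤; tt)
open import Function.Base using (flip; _∘_)
open import Function.Bundles using (mk⇔)
open import Induction.WellFounded using (Acc; acc)
open import Level using (0ℓ)
open import Relation.Binary.Construct.Closure.ReflexiveTransitive using (ε; _◅_; _◅◅_; gmap)
open import Relation.Binary.Core using (Rel)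
open import Relation.Binary.Definitions using (Transitive; tri<; tri≈; tri>)
open import Relation.Binary.PropositionalEquality
  using (_≡_; _≢_; refl; sym; trans; cong; cong₂; subst; subst₂; setoid; module ≡-Reasoning)
open import Relation.Nullary using (¬_; yes; no; contradiction)
open import Relation.Nullary.Decidable using (¬?; _×-dec_; _⊎-dec_)
open import Relation.Unary using (Pred; Decidable)

-- In the binary search tree of a word, the right subtree of v consists of the
-- longest run v+1, v+2, … of letters placed after v. Hence P σ = J says, for each
-- v, which run of larger letters stands after (or before) v and that the letter
-- following this run stands on the other side. When the inversion set of σ
-- grows, runs after v shrink and runs before v lengthen, so ω grows.
--
-- Conversely, insert the letters n, …, 1 one after the other: the letters to be
-- placed before v all precede those to be placed after v, so there is always
-- room. Placing v as early as possible for J₀ and as late as possible for J₁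
-- keeps the inversions of the first word among those of the second, and
-- inclusion of inversion sets is the permutohedron order.

-- Relative order of letters in a word

infix 4 _⊢_≺_

-- Encoded as a two-letter subsequence, so that passing to a longer word, concatenation and reversal
-- become facts about sublists.
_⊢_≺_ : List ℕ → ℕ → ℕ → Set
w ⊢ x ≺ y = x ∷ y ∷ [] ⊆ w

private variable
  w w′ u v : List ℕ
  x y z : ℕ

≺⇒∈ˡ : w ⊢ x ≺ y → x ∈ w
≺⇒∈ˡ p = to∈ p

≺⇒∈ʳ : w ⊢ x ≺ y → y ∈ w
≺⇒∈ʳ p = to∈ (Sublist.∷ˡ⁻ p)

head≺ : y ∈ w → x ∷ w ⊢ x ≺ y
head≺ p = refl ∷ from∈ p

≺-asym : Unique w → w ⊢ x ≺ y → ¬ w ⊢ y ≺ x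
≺-asym (_ ∷ uw) (_ ∷ʳ p)   (_ ∷ʳ q)   = ≺-asym uw p q
≺-asym (h ∷ _)  (_ ∷ʳ p)   (refl ∷ _) = All.lookup h (≺⇒∈ʳ p) refl
≺-asym (h ∷ _)  (refl ∷ _) (_ ∷ʳ q)   = All.lookup h (≺⇒∈ʳ q) refl
≺-asym (h ∷ _)  (refl ∷ p) (refl ∷ _) = All.lookup h (to∈ p) refl

≺-trans : Unique w → w ⊢ x ≺ y → w ⊢ y ≺ z → w ⊢ x ≺ z
≺-trans (_ ∷ uw) (_ ∷ʳ p)   (_ ∷ʳ q)   = _ ∷ʳ ≺-trans uw p q
≺-trans (h ∷ _)  (_ ∷ʳ p)   (refl ∷ _) = contradiction refl (All.lookup h (≺⇒∈ʳ p))
≺-trans (h ∷ _)  (refl ∷ _) (_ ∷ʳ q)   = head≺ (≺⇒∈ʳ q)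
≺-trans (h ∷ _)  (refl ∷ p) (refl ∷ _) = contradiction refl (All.lookup h (to∈ p))

≺-total : x ∈ w → y ∈ w → x ≢ y → w ⊢ x ≺ y ⊎ w ⊢ y ≺ x
≺-total (here refl) (here refl) x≢y = contradiction refl x≢y
≺-total (here refl) (there q)   _   = inj₁ (head≺ q)
≺-total (there p)   (here refl) _   = inj₂ (head≺ p)
≺-total (there p)   (there q)   x≢y with ≺-total p q x≢y
... | inj₁ r = inj₁ (_ ∷ʳ r)
... | inj₂ r = inj₂ (_ ∷ʳ r)

++-≺ : x ∈ u → y ∈ v → u ++ v ⊢ x ≺ y
++-≺ p q = Sublist.++⁺ (from∈ p) (from∈ q)

++-⊆-∷ : ∀ u → u ++ v ⊆ u ++ x ∷ v
++-⊆-∷ u = Sublist.++⁺ (⊆-refl {x = u}) (_ ∷ʳ ⊆-refl)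

reverse-≺ : w ⊢ x ≺ y → reverse w ⊢ y ≺ x
reverse-≺ = Sublist.reverse⁺

-- Inversion sets and the permutohedron order

infix 4 _⊑_

-- Inclusion of inversion sets, an inversion being a pair whose larger letter comes first.
_⊑_ : Rel (List ℕ) 0ℓ
σ ⊑ ν = ∀ {x y} → x < y → σ ⊢ y ≺ x → ν ⊢ y ≺ x

-- Swapping two adjacent letters alters the order of this pair only, and since `a < b` the pair was
-- no inversion before.
⋖P⇒⊑ : ∀ {σ ν} → σ ⋖P ν → σ ⊑ ν
⋖P⇒⊑ (swap [] v a<b) x<y (_ ∷ʳ (_ ∷ʳ p))      = _ ∷ʳ (_ ∷ʳ p)
⋖P⇒⊑ (swap [] v a<b) x<y (_ ∷ʳ (refl ∷ p))    = refl ∷ (_ ∷ʳ p)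
⋖P⇒⊑ (swap [] v a<b) x<y (refl ∷ (_ ∷ʳ p))    = _ ∷ʳ (refl ∷ p)
⋖P⇒⊑ (swap [] v a<b) x<y (refl ∷ (refl ∷ p))  = contradiction x<y (ℕ.<-asym a<b)
⋖P⇒⊑ (swap (c ∷ u) v a<b) x<y (_ ∷ʳ p)        = _ ∷ʳ ⋖P⇒⊑ (swap u v a<b) x<y p
⋖P⇒⊑ (swap (c ∷ u) {a} {b} v a<b) x<y (refl ∷ p) =
  refl ∷ from∈ (swap-∈ u (to∈ p))
  where
  swap-∈ : ∀ {x} u → x ∈ u ++ a ∷ b ∷ v → x ∈ u ++ b ∷ a ∷ v
  swap-∈ []      (here e)          = there (here e)
  swap-∈ []      (there (here e))  = here e
  swap-∈ []      (there (there e)) = there (there e)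
  swap-∈ (_ ∷ u) (here e)          = here e
  swap-∈ (_ ∷ u) (there e)         = there (swap-∈ u e)

≤P⇒⊑ : ∀ {σ ν} → σ ≤P ν → σ ⊑ ν
≤P⇒⊑ ε        _   p = p
≤P⇒⊑ (c ◅ cs) x<y p = ≤P⇒⊑ cs x<y (⋖P⇒⊑ c x<y p)

∷-⋖P : ∀ {σ ν} x → σ ⋖P ν → x ∷ σ ⋖P x ∷ ν
∷-⋖P x (swap u v a<b) = swap (x ∷ u) v a<b

bubble : ∀ u → (∀ {y} → y ∈ u → y < x) → u ++ x ∷ v ≤P x ∷ u ++ v
bubble []      _   = ε
bubble (a ∷ u) u<x =
  gmap (a ∷_) (∷-⋖P a) (bubble u (u<x ∘ there)) ◅◅ swap [] _ (u<x (here refl)) ◅ ε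

Unique-resp-↭ : w ↭ w′ → Unique w → Unique w′
Unique-resp-↭ p = Permutationₛ.Unique-resp-↭ (setoid ℕ) (↭⇒↭ₛ p)

Unique-remove : ∀ u → Unique (u ++ x ∷ v) → Unique (u ++ v)
Unique-remove u p with _ ∷ q ← Unique-resp-↭ (shift _ u _) p = q

Unique⇒∉ : ∀ u → Unique (u ++ x ∷ v) → x ∉ u ++ v
Unique⇒∉ u p q with h ∷ _ ← Unique-resp-↭ (shift _ u _) p = All.lookup h q refl

∈-remove : ∀ u → y ∈ u ++ x ∷ v → y ≢ x → y ∈ u ++ v
∈-remove u p y≢x with ∈-resp-↭ (shift _ u _) p
... | here e  = contradiction e y≢x
... | there q = q

-- The head of ν is preceded in σ by smaller letters only, so it can be bubbled
-- up to the front of σ.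
⊑⇒≤P : ∀ {σ ν} → Unique σ → Unique ν → (∀ {x} → x ∈ σ → x ∈ ν) → (∀ {x} → x ∈ ν → x ∈ σ) →
  σ ⊑ ν → σ ≤P ν
⊑⇒≤P {[]}    {[]}    _ _ _ _   _ = ε
⊑⇒≤P {_ ∷ _} {[]}    _ _ f _   _ with () ← f (here refl)
⊑⇒≤P {σ}     {h ∷ ν} uσ (h∉ν ∷ uν) f g σ⊑ν with ∈-∃++ (g (here refl))
... | u , v , refl =
  bubble u u<h ◅◅ gmap (h ∷_) (∷-⋖P h) (⊑⇒≤P (Unique-remove u uσ) uν to from ⊑′)
  where
  to : ∀ {x} → x ∈ u ++ v → x ∈ ν
  to p with f (Sublist.Any-resp-⊆ (++-⊆-∷ u) p)
  ... | here refl = contradiction p (Unique⇒∉ u uσ)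
  ... | there q   = q
  from : ∀ {x} → x ∈ ν → x ∈ u ++ v
  from p = ∈-remove u (g (there p)) λ { refl → All.lookup h∉ν p refl }
  u<h : ∀ {y} → y ∈ u → y < h
  u<h {y} p with ℕ.<-cmp y h
  ... | tri< y<h _ _ = y<h
  ... | tri≈ _ refl _ = contradiction (∈-++⁺ˡ p) (Unique⇒∉ u uσ)
  -- A larger letter `y` before `h` in `σ` would be an inversion, hence one of `h ∷ ν`; but there
  -- `h` comes first.
  ... | tri> _ _ h<y =
    ⊥-elim (≺-asym (h∉ν ∷ uν) (σ⊑ν h<y (++-≺ p (here refl))) (head≺ (to (∈-++⁺ˡ p))))
  ⊑′ : u ++ v ⊑ ν
  ⊑′ x<y p with σ⊑ν x<y (⊆-trans p (++-⊆-∷ u))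
  ... | _ ∷ʳ q   = q
  ... | refl ∷ q = contradiction (≺⇒∈ˡ p) (Unique⇒∉ u uσ)

-- Tamari diagrams and ends of right subtrees

infixl 9 _‼_

-- Positions count from 0 and read 0 past the end. The extra leading 0 in `reach` moves the letters
-- of `td` to the positions 1, 2, and so on.
_‼_ : List ℕ → ℕ → ℕ
[]       ‼ _     = 0
(x ∷ _)  ‼ zero  = x
(_ ∷ xs) ‼ suc i = xs ‼ i

‼-++ˡ : ∀ xs {ys i} → i < length xs → (xs ++ ys) ‼ i ≡ xs ‼ i
‼-++ˡ (x ∷ xs) {i = zero}  _         = refl
‼-++ˡ (x ∷ xs) {i = suc i} (s≤s i<k) = ‼-++ˡ xs i<k

‼-++ʳ : ∀ xs {ys k} i → length xs ≡ k → (xs ++ ys) ‼ (k + i) ≡ ys ‼ i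
‼-++ʳ []       i refl = refl
‼-++ʳ (x ∷ xs) i refl = ‼-++ʳ xs i refl

length-td : ∀ t → length (td t) ≡ #nodes t
length-td (leaf _)     = refl
length-td (node l _ r) =
  trans (length-++ (td l)) (cong₂ (λ a b → a + suc b) (length-td l) (length-td r))

-- The last node, in inorder numbered from 1, of the subtree formed by the v-th
-- node and its right subtree.
reach : BinaryTree → ℕ → ℕ
reach t v = v + (0 ∷ td t) ‼ v

v≤reach : ∀ t v → v ≤ⁿ reach t v
v≤reach t v = ℕ.m≤m+n v _

module _ (l r : BinaryTree) where

  private
    a = #nodes l
    b = #nodes r
    t = node l tt r

  reach-left : ∀ {v} → v ≤ⁿ a → reach t v ≡ reach l v
  reach-left {v} v≤a =
    cong (v +_) (‼-++ˡ (0 ∷ td l) (s≤s (subst (v ≤ⁿ_) (sym (length-td l)) v≤a)))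

  reach-root : reach t (suc a) ≡ a + suc b
  reach-root = trans
    (cong (suc a +_) (trans (cong ((0 ∷ td t) ‼_) (sym (ℕ.+-identityʳ (suc a))))
      (‼-++ʳ (0 ∷ td l) 0 (cong suc (length-td l)))))
    (sym (ℕ.+-suc a b))

  reach-right : ∀ j → reach t (suc a + suc j) ≡ suc a + reach r (suc j)
  reach-right j = trans
    (cong (suc a + suc j +_) (‼-++ʳ (0 ∷ td l) (suc j) (cong suc (length-td l))))
    (ℕ.+-assoc (suc a) (suc j) _)

-- In inorder the root has number `suc a` when its subtrees have `a` and `b` nodes. The number 0,
-- which no node carries, falls under `inLeft`.
data Position (a b : ℕ) : ℕ → Set where
  inLeft  : ∀ {v} → v ≤ⁿ a → Position a b v
  atRoot  : Position a b (suc a)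
  inRight : ∀ j → j < b → Position a b (suc a + suc j)

position : ∀ a b v → v ≤ⁿ a + suc b → Position a b v
position a b v v≤n with ℕ.<-cmp v (suc a)
... | tri< (s≤s v≤a) _ _ = inLeft v≤a
... | tri≈ _ refl _      = atRoot
... | tri> _ _ a<v with ℕ.m≤n⇒∃[o]m+o≡n a<v
...   | j , refl = subst (Position a b) (ℕ.+-suc (suc a) j)
        (inRight j (ℕ.+-cancelˡ-≤ (suc a) (suc j) b
          (subst₂ _≤ⁿ_ (sym (ℕ.+-suc (suc a) j)) (ℕ.+-suc a b) v≤n)))

reach-≤ : ∀ t {v} → v ≤ⁿ #nodes t → reach t v ≤ⁿ #nodes t
reach-≤ (leaf _) z≤n = z≤n
reach-≤ (node l _ r) v≤n with position (#nodes l) (#nodes r) _ v≤n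
... | inLeft v≤a rewrite reach-left l r v≤a = ℕ.≤-trans (reach-≤ l v≤a) (ℕ.m≤m+n _ _)
... | atRoot     rewrite reach-root l r = ℕ.≤-refl
... | inRight j j<b rewrite reach-right l r j | ℕ.+-suc (#nodes l) (#nodes r) =
  s≤s (ℕ.+-monoʳ-≤ (#nodes l) (reach-≤ r j<b))

-- Node `m` is `v` itself or lies in the right subtree of `v`, which then contains the right subtree
-- of `m` too.
reach-nested : ∀ t {v m} → v ≤ⁿ #nodes t → v ≤ⁿ m → m ≤ⁿ reach t v → reach t m ≤ⁿ reach t v
reach-nested (leaf _) z≤n v≤m m≤e = ℕ.≤-reflexive (trans (reach-leaf _) (ℕ.n≤0⇒n≡0 m≤e))
  where
  reach-leaf : ∀ v → reach (leaf tt) v ≡ v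
  reach-leaf zero    = refl
  reach-leaf (suc v) = ℕ.+-identityʳ (suc v)
reach-nested t@(node l _ r) {m = m} v≤n v≤m m≤e with position (#nodes l) (#nodes r) _ v≤n
... | inLeft v≤a rewrite reach-left l r v≤a
                       | reach-left l r (ℕ.≤-trans m≤e (reach-≤ l v≤a)) = reach-nested l v≤a v≤m m≤e
... | atRoot     rewrite reach-root l r = reach-≤ t m≤e
... | inRight j j<b with position (#nodes l) (#nodes r) m (ℕ.≤-trans m≤e (reach-≤ t v≤n))
...   | inLeft m≤a = ⊥-elim (ℕ.<⇒≱ (ℕ.m≤m+n (suc (#nodes l)) (suc j)) (ℕ.≤-trans v≤m m≤a))
...   | atRoot = ⊥-elim (ℕ.<⇒≱ (ℕ.m<m+n (suc (#nodes l)) {suc j} (s≤s z≤n)) v≤m)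
...   | inRight k k<b rewrite reach-right l r j | reach-right l r k =
  ℕ.+-monoʳ-≤ (suc (#nodes l)) (reach-nested r j<b (cancel v≤m) (cancel m≤e))
  where
  cancel : ∀ {x y} → suc (#nodes l) + x ≤ⁿ suc (#nodes l) + y → x ≤ⁿ y
  cancel = ℕ.+-cancelˡ-≤ (suc (#nodes l)) _ _

root< : ∀ (l r : BinaryTree) → #nodes l < #nodes (node l tt r)
root< l r = ℕ.m<m+n (#nodes l) (s≤s z≤n)

-- The root reaches the last node, while in the other tree the node with the same number sits in the
-- left subtree, which ends before the last node.
reach-root-left : ∀ (l r l′ r′ : BinaryTree) → #nodes l < #nodes l′ → #nodes (node l tt r) ≡ #nodes (node l′ tt r′) →
  reach (node l tt r) (suc (#nodes l)) ≢ reach (node l′ tt r′) (suc (#nodes l))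
reach-root-left l r l′ r′ a<a′ e same
  rewrite reach-root l r | reach-left l′ r′ a<a′ | e =
  ℕ.<⇒≱ (root< l′ r′) (ℕ.≤-trans (ℕ.≤-reflexive same) (reach-≤ l′ a<a′))

-- The root is the first node that reaches the last one, so `reach` determines the sizes of both
-- subtrees; induction then treats each of them, the right one after a shift.
reach-injective : ∀ (t t′ : BinaryTree) → #nodes t ≡ #nodes t′ →
  (∀ v → 0 < v → v ≤ⁿ #nodes t → reach t v ≡ reach t′ v) → t ≡ t′
reach-injective (leaf _) (leaf _) _ _ = refl
reach-injective (leaf _) (node l _ r) e _ with () ← trans e (ℕ.+-suc (#nodes l) (#nodes r))
reach-injective (node l _ r) (leaf _) e _ with () ← trans (sym e) (ℕ.+-suc (#nodes l) (#nodes r))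
reach-injective t@(node l _ r) t′@(node l′ _ r′) e same with ℕ.<-cmp (#nodes l) (#nodes l′)
... | tri< a<a′ _ _ =
  ⊥-elim (reach-root-left l r l′ r′ a<a′ e (same _ (s≤s z≤n) (root< l r)))
... | tri> _ _ a′<a =
  ⊥-elim (reach-root-left l′ r′ l r a′<a (sym e)
    (sym (same _ (s≤s z≤n) (subst (#nodes l′ <_) (sym e) (root< l′ r′)))))
... | tri≈ _ a≡a′ _ =
  cong₂ (λ l r → node l tt r) (reach-injective l l′ a≡a′ left) (reach-injective r r′ b≡b′ right)
  where
  b≡b′ : #nodes r ≡ #nodes r′
  b≡b′ = ℕ.suc-injective (ℕ.+-cancelˡ-≡ (#nodes l′) _ _ (subst (λ a → a + suc (#nodes r) ≡ #nodes t′) a≡a′ e))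
  left : ∀ v → 0 < v → v ≤ⁿ #nodes l → reach l v ≡ reach l′ v
  left v 0<v v≤a = begin
    reach l v   ≡⟨ reach-left l r v≤a ⟨
    reach t v   ≡⟨ same v 0<v (ℕ.≤-trans v≤a (ℕ.m≤m+n _ _)) ⟩
    reach t′ v  ≡⟨ reach-left l′ r′ (subst (v ≤ⁿ_) a≡a′ v≤a) ⟩
    reach l′ v  ∎
    where open ≡-Reasoning
  right : ∀ v → 0 < v → v ≤ⁿ #nodes r → reach r v ≡ reach r′ v
  right (suc j) _ j<b = ℕ.+-cancelˡ-≡ (suc (#nodes l)) _ _ (begin
    suc (#nodes l) + reach r (suc j)    ≡⟨ reach-right l r j ⟨
    reach t (suc (#nodes l) + suc j)    ≡⟨ same _ (s≤s z≤n) in-range ⟩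
    reach t′ (suc (#nodes l) + suc j)   ≡⟨ cong (λ a → reach t′ (suc a + suc j)) a≡a′ ⟩
    reach t′ (suc (#nodes l′) + suc j)  ≡⟨ reach-right l′ r′ j ⟩
    suc (#nodes l′) + reach r′ (suc j)  ≡⟨ cong (λ a → suc a + reach r′ (suc j)) a≡a′ ⟨
    suc (#nodes l) + reach r′ (suc j)   ∎)
    where
    open ≡-Reasoning
    in-range : suc (#nodes l) + suc j ≤ⁿ #nodes l + suc (#nodes r)
    in-range = subst (suc (#nodes l) + suc j ≤ⁿ_) (sym (ℕ.+-suc (#nodes l) _))
      (ℕ.+-monoʳ-≤ (suc (#nodes l)) j<b)

-- Runs of letters and binary search trees

-- What a tree demands of the words from which insertion builds it. The bound `p` serves words that
-- still lack the letters up to `p`; the order is a parameter so that it can be shifted or reversed.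
Runs : Rel ℕ 0ℓ → BinaryTree → ℕ → ℕ → Set
Runs _≺_ t p n = ∀ {v} → p < v → v ≤ⁿ n →
  (∀ {m} → v < m → m ≤ⁿ reach t v → v ≺ m) × (reach t v < n → suc (reach t v) ≺ v)

-- The root precedes every other letter. This covers the root itself and each left node whose right
-- subtree ends at the last left node, as the root is the next letter; all other conditions are
-- those of the subtrees.
runs-node : ∀ {_≺_ : Rel ℕ 0ℓ} l r →
  Runs _≺_ l 0 (#nodes l) →
  Runs (λ i j → (suc (#nodes l) + i) ≺ (suc (#nodes l) + j)) r 0 (#nodes r) →
  (∀ {v} → 0 < v → v ≤ⁿ #nodes l + suc (#nodes r) → v ≢ suc (#nodes l) → suc (#nodes l) ≺ v) →
  Runs _≺_ (node l tt r) 0 (#nodes l + suc (#nodes r))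
runs-node {_≺_} l r left right root {v} 0<v v≤n with position (#nodes l) (#nodes r) v v≤n
... | inLeft v≤a rewrite reach-left l r v≤a = proj₁ (left 0<v v≤a) , after
  where
  after : reach l v < #nodes l + suc (#nodes r) → suc (reach l v) ≺ v
  after _ with ℕ.m≤n⇒m<n∨m≡n (reach-≤ l v≤a)
  ... | inj₁ e<a = proj₂ (left 0<v v≤a) e<a
  ... | inj₂ e≡a rewrite e≡a = root 0<v v≤n (ℕ.<⇒≢ (s≤s v≤a))
... | atRoot rewrite reach-root l r =
  (λ v<m m≤n → root (ℕ.<-trans (s≤s z≤n) v<m) m≤n (ℕ.>⇒≢ v<m)) ,
  (λ n<n → ⊥-elim (ℕ.<-irrefl refl n<n))
... | inRight j j<b rewrite reach-right l r j = before , after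
  where
  a = suc (#nodes l)
  before : ∀ {m} → a + suc j < m → m ≤ⁿ a + reach r (suc j) → (a + suc j) ≺ m
  before {m} v<m m≤e with ℕ.m≤n⇒∃[o]m+o≡n (ℕ.≤-trans (ℕ.m≤m+n a (suc j)) (ℕ.<⇒≤ v<m))
  ... | k , refl = proj₁ (right (s≤s z≤n) j<b) (ℕ.+-cancelˡ-< a _ _ v<m) (ℕ.+-cancelˡ-≤ a _ _ m≤e)
  after : a + reach r (suc j) < #nodes l + suc (#nodes r) → suc (a + reach r (suc j)) ≺ (a + suc j)
  after e<n = subst (_≺ (a + suc j)) (ℕ.+-suc a _) (proj₂ (right (s≤s z≤n) j<b)
    (ℕ.+-cancelˡ-< a _ _ (subst (a + reach r (suc j) <_) (ℕ.+-suc (#nodes l) _) e<n)))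

insertAll : Tree ℕ ⊤ → List ℕ → Tree ℕ ⊤
insertAll = foldl (flip insert)

insert-< : ∀ l r → y < x → insert y (node l x r) ≡ node (insert y l) x r
insert-< {y} {x} l r y<x with y <? x
... | yes _  = refl
... | no y≮x = contradiction y<x y≮x

insert-≥ : ∀ l r → x ≤ⁿ y → insert y (node l x r) ≡ node l x (insert y r)
insert-≥ {x} {y} l r x≤y with y <? x
... | yes y<x = contradiction x≤y (ℕ.<⇒≱ y<x)
... | no _    = refl

insertAll-node : ∀ l x r w → insertAll (node l x r) w ≡
  node (insertAll l (filter (_<? x) w)) x (insertAll r (filter (¬? ∘ (_<? x)) w))
insertAll-node l x r []      = refl
insertAll-node l x r (y ∷ w) with ℕ.<-≤-connex y x
... | inj₁ y<x rewrite insert-< l r y<x | filter-accept (_<? x) {xs = w} y<x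
                     | filter-reject (¬? ∘ (_<? x)) {xs = w} (λ y≮x → y≮x y<x) =
  insertAll-node (insert y l) x r w
... | inj₂ x≤y rewrite insert-≥ l r x≤y | filter-reject (_<? x) {xs = w} (ℕ.≤⇒≯ x≤y)
                     | filter-accept (¬? ∘ (_<? x)) {xs = w} (ℕ.≤⇒≯ x≤y) =
  insertAll-node l x (insert y r) w

-- Intervals of letters occur in two ways: as the labels of a subtree of a binary search tree, and
-- as the letters above `p` in a partially built permutation.
record Enumerates (lo hi : ℕ) (w : List ℕ) : Set where
  field
    unique   : Unique w
    sound    : ∀ {x} → x ∈ w → lo < x × x ≤ⁿ hi
    complete : ∀ {x} → lo < x → x ≤ⁿ hi → x ∈ w

open Enumerates

splitRange : ∀ lo n {x} → lo < x → x ≤ⁿ lo + n → ∃₂ λ a b → x ≡ suc (lo + a) × n ≡ a + suc b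
splitRange lo n lo<x x≤n with ℕ.m≤n⇒∃[o]m+o≡n lo<x
... | a , refl with ℕ.m≤n⇒∃[o]m+o≡n (ℕ.+-cancelˡ-≤ lo _ _ (subst (_≤ⁿ lo + n) (sym (ℕ.+-suc lo a)) x≤n))
...   | b , refl = a , b , refl , sym (ℕ.+-suc a b)

module _ {lo a b : ℕ} {w : List ℕ} (enum : Enumerates lo (lo + (a + suc b)) (suc (lo + a) ∷ w)) where

  private
    c = suc (lo + a)

    hi≡ : lo + (a + suc b) ≡ c + b
    hi≡ = trans (sym (ℕ.+-assoc lo a (suc b))) (ℕ.+-suc (lo + a) b)

    ∈-tail : ∀ {y} → lo < y → y ≤ⁿ lo + (a + suc b) → y ≢ c → y ∈ w
    ∈-tail lo<y y≤hi y≢c with complete enum lo<y y≤hi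
    ... | here y≡c = contradiction y≡c y≢c
    ... | there p  = p

    unique-tail : Unique w
    unique-tail with _ ∷ u ← unique enum = u

  enumerates-smaller : Enumerates lo (lo + a) (filter (_<? c) w)
  unique   enumerates-smaller = Unique.filter⁺ (_<? c) unique-tail
  sound    enumerates-smaller p with ∈-filter⁻ (_<? c) {xs = w} p
  ... | q , y<c = proj₁ (sound enum (there q)) , ℕ.≤-pred y<c
  complete enumerates-smaller lo<y y≤ = ∈-filter⁺ (_<? c)
    (∈-tail lo<y (ℕ.≤-trans y≤ (ℕ.+-monoʳ-≤ lo (ℕ.m≤m+n a _))) (ℕ.<⇒≢ (s≤s y≤))) (s≤s y≤)

  enumerates-larger : Enumerates c (c + b) (filter (¬? ∘ (_<? c)) w)
  unique   enumerates-larger = Unique.filter⁺ (¬? ∘ (_<? c)) unique-tail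
  sound    enumerates-larger {y} p with ∈-filter⁻ (¬? ∘ (_<? c)) {xs = w} p
  ... | q , y≮c = ℕ.≤∧≢⇒< (ℕ.≮⇒≥ y≮c) (All.lookup (x∉ (unique enum)) q) ,
                  subst (y ≤ⁿ_) hi≡ (proj₂ (sound enum (there q)))
    where
    x∉ : ∀ {x : ℕ} {w} → Unique (x ∷ w) → All.All (x ≢_) w
    x∉ (h ∷ _) = h
  complete enumerates-larger {y} c<y y≤ = ∈-filter⁺ (¬? ∘ (_<? c))
    (∈-tail (ℕ.<-trans (s≤s (ℕ.m≤m+n lo a)) c<y) (subst (y ≤ⁿ_) (sym hi≡) y≤) (ℕ.>⇒≢ c<y)) (ℕ.<-asym c<y)

bst : List ℕ → BinaryTree
bst w = shape (insertAll (leaf tt) w)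

runs-mono : ∀ {_≺_ _≺′_ : Rel ℕ 0ℓ} {p n} t → (∀ {i j} → i ≺ j → i ≺′ j) →
  Runs _≺_ t p n → Runs _≺′_ t p n
runs-mono _ f runs p<v v≤n = (λ v<m m≤e → f (proj₁ (runs p<v v≤n) v<m m≤e)) ,
  (λ e<n → f (proj₂ (runs p<v v≤n) e<n))

runs-pivot : ∀ {lo a b w} l r (let x = suc (lo + a)) → Enumerates lo (lo + (a + suc b)) (x ∷ w) →
  #nodes l ≡ a × Runs (λ i j → w ⊢ lo + i ≺ lo + j) l 0 a →
  #nodes r ≡ b × Runs (λ i j → w ⊢ x + i ≺ x + j) r 0 b →
  #nodes (node l tt r) ≡ a + suc b × Runs (λ i j → x ∷ w ⊢ lo + i ≺ lo + j) (node l tt r) 0 (a + suc b)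
runs-pivot {lo} {a} {b} {w} l r enum (refl , left) (refl , right) =
  refl , runs-node l r (runs-mono l (c ∷ʳ_) left) (runs-mono r offset right) root
  where
  c = suc (lo + a)
  offset-≡ : ∀ i → c + i ≡ lo + (suc a + i)
  offset-≡ i = trans (cong suc (ℕ.+-assoc lo a i)) (sym (ℕ.+-suc lo (a + i)))
  offset : ∀ {i j} → w ⊢ c + i ≺ c + j → c ∷ w ⊢ lo + (suc a + i) ≺ lo + (suc a + j)
  offset {i} {j} p = c ∷ʳ subst₂ (w ⊢_≺_) (offset-≡ i) (offset-≡ j) p
  root : ∀ {v} → 0 < v → v ≤ⁿ a + suc b → v ≢ suc a → c ∷ w ⊢ lo + suc a ≺ lo + v
  root {v} 0<v v≤n v≢a with complete enum (ℕ.m<m+n lo 0<v) (ℕ.+-monoʳ-≤ lo v≤n)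
  ... | here e  = contradiction (ℕ.+-cancelˡ-≡ lo _ _ (trans e (sym (ℕ.+-suc lo a)))) v≢a
  ... | there p = subst (λ y → c ∷ w ⊢ y ≺ lo + v) (sym (ℕ.+-suc lo a)) (head≺ p)

-- The first letter is the root, and its subtrees come from the smaller and the larger letters,
-- whose order in the filtered words is that in the whole word. The filtered words are no subterms,
-- whence the recursion on accessibility.
bst-runs : ∀ {lo n} w → Acc _<_ n → Enumerates lo (lo + n) w →
  #nodes (bst w) ≡ n × Runs (λ i j → w ⊢ lo + i ≺ lo + j) (bst w) 0 n
bst-runs {lo} {zero}  [] _ _    = refl , λ { (s≤s _) () }
bst-runs {lo} {suc n} [] _ enum
  with () ← complete enum (ℕ.m<m+n lo (s≤s z≤n)) ℕ.≤-refl
bst-runs {lo} {n} (x ∷ w) (acc rec) enum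
  with splitRange lo n (proj₁ (sound enum (here refl))) (proj₂ (sound enum (here refl)))
... | a , b , refl , refl rewrite insertAll-node (leaf tt) x (leaf tt) w =
  runs-pivot (bst smaller) (bst larger) enum
    (widen smaller (Sublist.filter-⊆ (_<? x) w)
      (bst-runs smaller (rec (ℕ.m<m+n a (s≤s z≤n))) (enumerates-smaller enum)))
    (widen larger (Sublist.filter-⊆ (¬? ∘ (_<? x)) w)
      (bst-runs larger (rec (ℕ.m≤n+m (suc b) a)) (enumerates-larger enum)))
  where
  smaller = filter (_<? x) w
  larger  = filter (¬? ∘ (_<? x)) w
  widen : ∀ {w′ lo n} w → w ⊆ w′ →
    #nodes (bst w) ≡ n × Runs (λ i j → w ⊢ lo + i ≺ lo + j) (bst w) 0 n →
    #nodes (bst w) ≡ n × Runs (λ i j → w′ ⊢ lo + i ≺ lo + j) (bst w) 0 n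
  widen w w⊆w′ (e , runs) = e , runs-mono (bst w) (λ p → ⊆-trans p w⊆w′) runs

-- Canopies in terms of Tamari diagrams

flag : ℕ → Fin 2
flag zero    = 0F
flag (suc _) = 1F

-- The first leaf of a nonempty tree is a left child, so the initial letter `0F` shows only when the
-- tree is a leaf: hence `flag (#nodes t)`.
leafWord-0F : ∀ t → leafWord 0F t ≡ flag (#nodes t) ∷ map flag (td t)
leafWord-1F : ∀ t → leafWord 1F t ≡ 1F ∷ map flag (td t)

leafWord-node : ∀ l r → leafWord 1F l ++ leafWord 0F r ≡ 1F ∷ map flag (td (node l tt r))
leafWord-node l r = trans (cong₂ _++_ (leafWord-1F l) (leafWord-0F r))
  (cong (1F ∷_) (sym (map-++ flag (td l) _)))

leafWord-0F (leaf _)     = refl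
leafWord-0F (node l _ r) = trans (leafWord-node l r)
  (cong (λ k → flag k ∷ map flag (td (node l tt r))) (sym (ℕ.+-suc (#nodes l) (#nodes r))))

leafWord-1F (leaf _)     = refl
leafWord-1F (node l _ r) = leafWord-node l r

dropEnds-∷ : ∀ {A : Set} (c : A) xs → dropEnds (c ∷ xs) ≡ take (length xs ∸ 1) xs
dropEnds-∷ c []       = refl
dropEnds-∷ c (_ ∷ xs) = refl

-- The leaf between two consecutive nodes is a left child exactly when the first
-- of them has a right child.
canopy-td : ∀ t → canopy t ≡ take (#nodes t ∸ 1) (map flag (td t))
canopy-td t rewrite leafWord-0F t =
  trans (dropEnds-∷ (flag (#nodes t)) (map flag (td t))) (cong (λ k → take (k ∸ 1) (map flag (td t)))
    (trans (length-map flag (td t)) (length-td t)))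

take-map-lookup : ∀ {A : Set} {R : Rel A 0ℓ} (f : ℕ → A) k xs ys {i} → i < k → i < length xs → i < length ys →
  Pointwise R (take k (map f xs)) (take k (map f ys)) → R (f (xs ‼ i)) (f (ys ‼ i))
take-map-lookup f (suc k) (x ∷ xs) (y ∷ ys) {zero}  _ _ _ (r ∷ _) = r
take-map-lookup f (suc k) (x ∷ xs) (y ∷ ys) {suc i} (s≤s p) (s≤s q) (s≤s r) (_ ∷ rs) =
  take-map-lookup f k xs ys p q r rs

-- Comparison of ω and comparison of reaches

-- A positive `a` hides `b` from `ω-letter`; the hypothesis, which holds for twin trees, makes `b`
-- zero then.
ω-letter-≤⁻ : ∀ {a b c d} → (0 < a → b ≡ 0) → ω-letter a b ≤ ω-letter c d → c ≤ⁿ a × b ≤ⁿ d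
ω-letter-≤⁻ {zero}  {c = zero}  _    (+≤+ b≤d) = z≤n , b≤d
ω-letter-≤⁻ {suc a} {c = zero}  a>0⇒ _ rewrite a>0⇒ (s≤s z≤n) = z≤n , z≤n
ω-letter-≤⁻ {suc a} {c = suc c} a>0⇒ (-≤- c≤a) rewrite a>0⇒ (s≤s z≤n) = s≤s c≤a , z≤n

ω-letter-≤⁺ : ∀ {a b c d} → c ≤ⁿ a → b ≤ⁿ d → ω-letter a b ≤ ω-letter c d
ω-letter-≤⁺ {zero}          z≤n       b≤d = +≤+ b≤d
ω-letter-≤⁺ {suc a}         z≤n       b≤d = -≤+
ω-letter-≤⁺ {suc a} {c = suc c} (s≤s c≤a) b≤d = -≤- c≤a

module _ {B : Set} {R : Rel B 0ℓ} {f : ℕ → ℕ → B} where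

  zipWith-lookup : ∀ {n} as bs cs ds → length as ≡ n → length bs ≡ n → length cs ≡ n → length ds ≡ n →
    Pointwise R (zipWith f as bs) (zipWith f cs ds) →
    ∀ {i} → i < n → R (f (as ‼ i) (bs ‼ i)) (f (cs ‼ i) (ds ‼ i))
  zipWith-lookup (_ ∷ _) (_ ∷ _) (_ ∷ _) (_ ∷ _) refl _ _ _ (r ∷ _) {zero} _ = r
  zipWith-lookup (_ ∷ as) (_ ∷ bs) (_ ∷ cs) (_ ∷ ds) refl p q r (_ ∷ rs) {suc i} (s≤s i<n) =
    zipWith-lookup as bs cs ds refl (ℕ.suc-injective p) (ℕ.suc-injective q) (ℕ.suc-injective r) rs i<n

  zipWith-tabulate : ∀ {n} as bs cs ds → length as ≡ n → length bs ≡ n → length cs ≡ n → length ds ≡ n →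
    (∀ {i} → i < n → R (f (as ‼ i) (bs ‼ i)) (f (cs ‼ i) (ds ‼ i))) →
    Pointwise R (zipWith f as bs) (zipWith f cs ds)
  zipWith-tabulate [] [] [] [] refl _ _ _ _ = []
  zipWith-tabulate (_ ∷ as) (_ ∷ bs) (_ ∷ cs) (_ ∷ ds) refl p q r h =
    h (s≤s z≤n) ∷
    zipWith-tabulate as bs cs ds refl (ℕ.suc-injective p) (ℕ.suc-injective q) (ℕ.suc-injective r) (h ∘ s≤s)

open TwinBinaryTrees

module _ {n : ℕ} (J : TwinBinaryTrees n) where

  reachᴸ reachᴿ : ℕ → ℕ
  reachᴸ = reach (left J)
  reachᴿ = reach (right J)

  reachᴸ-≤ : ∀ {v} → v ≤ⁿ n → reachᴸ v ≤ⁿ n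
  reachᴸ-≤ {v} v≤n = subst (reachᴸ v ≤ⁿ_) (left-size J)
    (reach-≤ (left J) (subst (v ≤ⁿ_) (sym (left-size J)) v≤n))

  reachᴿ-≤ : ∀ {v} → v ≤ⁿ n → reachᴿ v ≤ⁿ n
  reachᴿ-≤ {v} v≤n = subst (reachᴿ v ≤ⁿ_) (right-size J)
    (reach-≤ (right J) (subst (v ≤ⁿ_) (sym (right-size J)) v≤n))

  length-tdᴸ : length (td (left J)) ≡ n
  length-tdᴸ = trans (length-td (left J)) (left-size J)

  length-tdᴿ : length (td (right J)) ≡ n
  length-tdᴿ = trans (length-td (right J)) (right-size J)

  -- By `canopy-td`, letter `v` of a canopy tells whether node `v` has a right child, and twin
  -- canopies disagree on it. The last node has no letter in the canopy, hence `v < n`.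
  twin : ∀ {v} → 0 < v → v < n → (v < reachᴸ v × reachᴿ v ≡ v) ⊎ (reachᴸ v ≡ v × v < reachᴿ v)
  twin {suc i} _ v<n@(s≤s i<n-1) = flags (td (left J) ‼ i) (td (right J) ‼ i)
    (take-map-lookup flag (n ∸ 1) (td (left J)) (td (right J)) i<n-1
      (subst (i <_) (sym length-tdᴸ) (ℕ.<⇒≤ v<n)) (subst (i <_) (sym length-tdᴿ) (ℕ.<⇒≤ v<n)) differ)
    where
    canopy-n : ∀ t → #nodes t ≡ n → canopy t ≡ take (n ∸ 1) (map flag (td t))
    canopy-n t e = trans (canopy-td t) (cong (λ k → take (k ∸ 1) (map flag (td t))) e)
    differ : Pointwise _≢_ (take (n ∸ 1) (map flag (td (left J)))) (take (n ∸ 1) (map flag (td (right J))))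
    differ = subst₂ (Pointwise _≢_) (canopy-n (left J) (left-size J)) (canopy-n (right J) (right-size J))
      (canopies-differ J)
    flags : ∀ a b → flag a ≢ flag b →
      (suc i < suc i + a × suc i + b ≡ suc i) ⊎ (suc i + a ≡ suc i × suc i < suc i + b)
    flags zero    zero    ne = contradiction refl ne
    flags zero    (suc b) _  = inj₂ (ℕ.+-identityʳ _ , ℕ.m<m+n _ (s≤s z≤n))
    flags (suc a) zero    _  = inj₁ (ℕ.m<m+n _ (s≤s z≤n) , ℕ.+-identityʳ _)
    flags (suc a) (suc b) ne = contradiction refl ne

infix 4 _⊴_

-- The comparison of `ω` freed of signs: letters of the left tree enter `ω` negatively, so their
-- inequality turns around.
_⊴_ : ∀ {n} → TwinBinaryTrees n → TwinBinaryTrees n → Set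
_⊴_ {n} J₀ J₁ = ∀ {v} → 0 < v → v ≤ⁿ n → reachᴸ J₁ v ≤ⁿ reachᴸ J₀ v × reachᴿ J₀ v ≤ⁿ reachᴿ J₁ v

module _ {n : ℕ} (J₀ J₁ : TwinBinaryTrees n) where

  ω≤⇒⊴ : Pointwise _≤_ (ω (ttd J₀)) (ω (ttd J₁)) → J₀ ⊴ J₁
  ω≤⇒⊴ ω≤ {suc i} 0<v v≤n with ω-letter-≤⁻ exclusive
      (zipWith-lookup (td (left J₀)) (td (right J₀)) (td (left J₁)) (td (right J₁))
        (length-tdᴸ J₀) (length-tdᴿ J₀)
        (length-tdᴸ J₁) (length-tdᴿ J₁) ω≤ v≤n)
    where
    letter-0 : ∀ a → suc i + a ≡ suc i → a ≡ 0
    letter-0 a e = ℕ.+-cancelˡ-≡ (suc i) a 0 (trans e (sym (ℕ.+-identityʳ _)))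
    exclusive : 0 < td (left J₀) ‼ i → td (right J₀) ‼ i ≡ 0
    exclusive 0<a with ℕ.m≤n⇒m<n∨m≡n v≤n
    -- The canopies are silent about the last node, whose right subtree is empty since no reach
    -- exceeds `n`.
    ... | inj₂ refl = contradiction (reachᴸ-≤ J₀ v≤n) (ℕ.<⇒≱ (ℕ.m<m+n (suc i) 0<a))
    ... | inj₁ v<n with twin J₀ 0<v v<n
    ...   | inj₁ (_ , e) = letter-0 _ e
    ...   | inj₂ (e , _) = contradiction (sym (letter-0 _ e)) (ℕ.<⇒≢ 0<a)
  ... | c≤a , b≤d = ℕ.+-monoʳ-≤ (suc i) c≤a , ℕ.+-monoʳ-≤ (suc i) b≤d

  ⊴⇒ω≤ : J₀ ⊴ J₁ → Pointwise _≤_ (ω (ttd J₀)) (ω (ttd J₁))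
  ⊴⇒ω≤ J₀⊴J₁ = zipWith-tabulate (td (left J₀)) (td (right J₀)) (td (left J₁)) (td (right J₁))
    (length-tdᴸ J₀) (length-tdᴿ J₀)
    (length-tdᴸ J₁) (length-tdᴿ J₁)
    λ {i} i<n → let p , q = J₀⊴J₁ (s≤s z≤n) i<n in
      ω-letter-≤⁺ (ℕ.+-cancelˡ-≤ (suc i) _ _ p) (ℕ.+-cancelˡ-≤ (suc i) _ _ q)

-- Letters to be placed before and after v

-- For the insertion of v into a word listing the letters greater than v:
-- Pre J v are the letters to be placed before v, and Post J v those after it.
Pre Post : ∀ {n} → TwinBinaryTrees n → ℕ → Pred ℕ 0ℓ
Pre  J v m = (v < m × m ≤ⁿ reachᴿ J v) ⊎ m ≡ suc (reachᴸ J v)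
Post J v m = (v < m × m ≤ⁿ reachᴸ J v) ⊎ m ≡ suc (reachᴿ J v)

Pre? : ∀ {n} (J : TwinBinaryTrees n) v → Decidable (Pre J v)
Pre? J v m = (v <? m ×-dec m ℕ.≤? reachᴿ J v) ⊎-dec m ℕ.≟ suc (reachᴸ J v)

Post? : ∀ {n} (J : TwinBinaryTrees n) v → Decidable (Post J v)
Post? J v m = (v <? m ×-dec m ℕ.≤? reachᴸ J v) ⊎-dec m ℕ.≟ suc (reachᴿ J v)

-- The chain m ↦ suc (reach t m) leads from any m in the right subtree of v to
-- suc (reach t v), and it goes backwards for _≺_.
reach-chain : ∀ {_≺_ : Rel ℕ 0ℓ} t {v n} → Transitive _≺_ → #nodes t ≡ n → Runs _≺_ t v n →
  v ≤ⁿ n → reach t v < n → ∀ {m} → v < m → m ≤ⁿ reach t v → suc (reach t v) ≺ m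
reach-chain {_≺_} t {v} trans-≺ refl runs v≤n e<n {m} v<m m≤e = chain (reach t v) v<m m≤e (ℕ.m≤n+m (reach t v) m)
  where
  -- `k` bounds the number of steps left: each passage to `suc (reach t m)` increases `m`.
  chain : ∀ k {m} → v < m → m ≤ⁿ reach t v → reach t v ≤ⁿ m + k → suc (reach t v) ≺ m
  chain k {m} v<m m≤e e≤m+k with proj₂ (runs v<m (ℕ.≤-trans m≤e (ℕ.<⇒≤ e<n)))
                           | ℕ.m≤n⇒m<n∨m≡n (reach-nested t v≤n (ℕ.<⇒≤ v<m) m≤e)
  ... | next | inj₂ e′≡e = subst (λ e → suc e ≺ m) e′≡e (next (subst (_< #nodes t) (sym e′≡e) e<n))
  chain zero {m} v<m m≤e e≤m+0 | next | inj₁ e′<e =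
    contradiction (ℕ.≤-trans e≤m+0 (subst (_≤ⁿ reach t m) (sym (ℕ.+-identityʳ m)) (v≤reach t m))) (ℕ.<⇒≱ e′<e)
  chain (suc k) {m} v<m m≤e e≤m+k | next | inj₁ e′<e =
    trans-≺ (chain k (ℕ.<-trans v<m (s≤s (v≤reach t m))) e′<e
      (ℕ.≤-trans (subst (reach t v ≤ⁿ_) (ℕ.+-suc m k) e≤m+k) (ℕ.+-monoˡ-≤ k (s≤s (v≤reach t m)))))
      (next (ℕ.<-trans e′<e e<n))

-- A stage of the construction, with the letters above `p` in place. The right tree sees the
-- reversed order because its insertion reads the word from right to left.
record Realises {n} (J : TwinBinaryTrees n) (p : ℕ) (w : List ℕ) : Set where
  field
    enumerates : Enumerates p n w
    runsᴸ      : Runs (w ⊢_≺_) (left J) p n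
    runsᴿ      : Runs (flip (w ⊢_≺_)) (right J) p n

open Realises

module _ {n : ℕ} (J : TwinBinaryTrees n) where

  Pre⇒< : ∀ {v m} → Pre J v m → v < m
  Pre⇒< (inj₁ (v<m , _)) = v<m
  Pre⇒< (inj₂ refl)      = s≤s (v≤reach (left J) _)

  Post⇒< : ∀ {v m} → Post J v m → v < m
  Post⇒< (inj₁ (v<m , _)) = v<m
  Post⇒< (inj₂ refl)      = s≤s (v≤reach (right J) _)

  -- By `twin` one of the two reaches of `v` is `v` itself. If it is the right one, the only letter
  -- in `Pre` is `suc (reachᴸ J v)`, and all of `Post`, including `suc v`, lies in the left run, so
  -- `reach-chain` applies; the other case is its mirror image.
  Pre≺Post : ∀ {v w d e} → 0 < v → Realises J v w → d ≤ⁿ n → e ≤ⁿ n →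
    Pre J v d → Post J v e → w ⊢ d ≺ e
  Pre≺Post {v} {w} {d} {e} 0<v real d≤n e≤n pre post with twin J 0<v (ℕ.<-≤-trans (Pre⇒< pre) d≤n)
  ... | inj₁ (v<L , R≡v) = onL pre post
    where
    v≤n = ℕ.≤-trans (ℕ.<⇒≤ (Pre⇒< pre)) d≤n
    onL : Pre J v d → Post J v e → w ⊢ d ≺ e
    onL (inj₁ (v<d , d≤R)) _ = contradiction (ℕ.≤-trans d≤R (ℕ.≤-reflexive R≡v)) (ℕ.<⇒≱ v<d)
    onL (inj₂ refl) post = reach-chain (left J) (≺-trans (unique (enumerates real))) (left-size J)
      (runsᴸ real) v≤n d≤n (Post⇒< post) (e≤L post)
      where
      e≤L : Post J v e → e ≤ⁿ reachᴸ J v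
      e≤L (inj₁ (_ , e≤L)) = e≤L
      e≤L (inj₂ refl)      = subst (λ r → suc r ≤ⁿ reachᴸ J v) (sym R≡v) v<L
  ... | inj₂ (L≡v , v<R) = onR pre post
    where
    v≤n = ℕ.≤-trans (ℕ.<⇒≤ (Pre⇒< pre)) d≤n
    onR : Pre J v d → Post J v e → w ⊢ d ≺ e
    onR _ (inj₁ (v<e , e≤L)) = contradiction (ℕ.≤-trans e≤L (ℕ.≤-reflexive L≡v)) (ℕ.<⇒≱ v<e)
    onR pre (inj₂ refl) = reach-chain {flip (w ⊢_≺_)} (right J) (λ p q → ≺-trans (unique (enumerates real)) q p)
      (right-size J) (runsᴿ real) v≤n e≤n (Pre⇒< pre) (d≤R pre)
      where
      d≤R : Pre J v d → d ≤ⁿ reachᴿ J v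
      d≤R (inj₁ (_ , d≤R)) = d≤R
      d≤R (inj₂ refl)      = subst (λ r → suc r ≤ⁿ reachᴿ J v) (sym L≡v) v<R

-- Cutting a word and inserting the next letter

infix 4 _⊢_≼_

_⊢_≼_ : List ℕ → ℕ → ℕ → Set
w ⊢ x ≼ y = x ≡ y ⊎ w ⊢ x ≺ y

≼-∷ : w ⊢ x ≼ y → z ∷ w ⊢ x ≼ y
≼-∷ (inj₁ e) = inj₁ e
≼-∷ (inj₂ p) = inj₂ (_ ∷ʳ p)

≼-≺-trans : Unique w → w ⊢ x ≼ y → w ⊢ y ≺ z → w ⊢ x ≺ z
≼-≺-trans _  (inj₁ refl) q = q
≼-≺-trans uw (inj₂ p)    q = ≺-trans uw p q

≺⇒⋠ : Unique w → w ⊢ x ≺ y → ¬ w ⊢ y ≼ x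
≺⇒⋠ uw p (inj₁ refl) = ≺-asym uw p p
≺⇒⋠ uw p (inj₂ q)    = ≺-asym uw p q

module _ {D : Pred ℕ 0ℓ} (D? : Decidable D) where

  -- Applied to `Pre`, this finds the earliest place for a new letter; the `d` attached to `m`
  -- witnesses why `m` has to stay before the cut.
  cutAfterLast : ∀ w → ∃₂ λ u v → w ≡ u ++ v ×
    (∀ {m} → m ∈ u → ∃ λ d → D d × d ∈ w × w ⊢ m ≼ d) × (∀ {m} → m ∈ v → ¬ D m)
  cutAfterLast [] = [] , [] , refl , (λ ()) , (λ ())
  cutAfterLast (x ∷ w) with cutAfterLast w
  -- A nonempty prefix shows that `D` occurs in the tail, so `x` stays before the cut whether or not
  -- `D x` holds.
  ... | y ∷ u , v , refl , before , none = x ∷ y ∷ u , v , refl , before′ , none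
    where
    before′ : ∀ {m} → m ∈ x ∷ y ∷ u → ∃ λ d → D d × d ∈ x ∷ w × x ∷ w ⊢ m ≼ d
    before′ (here refl) with d , Dd , d∈w , _ ← before (here refl) = d , Dd , there d∈w , inj₂ (head≺ d∈w)
    before′ (there p)   with d , Dd , d∈w , m≼d ← before p         = d , Dd , there d∈w , ≼-∷ m≼d
  ... | [] , v , refl , _ , none with D? x
  ...   | yes Dx = x ∷ [] , v , refl , (λ { (here refl) → x , Dx , here refl , inj₁ refl }) , none
  ...   | no ¬Dx = [] , x ∷ v , refl , (λ ()) , (λ { (here refl) → ¬Dx ; (there p) → none p })

  -- Applied to `Post`, this finds the latest place for a new letter.
  cutBeforeFirst : ∀ w → ∃₂ λ u v → w ≡ u ++ v ×
    (∀ {m} → m ∈ u → ¬ D m) × (∀ {m} → m ∈ v → ∃ λ d → D d × d ∈ w × w ⊢ d ≼ m)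
  cutBeforeFirst [] = [] , [] , refl , (λ ()) , (λ ())
  cutBeforeFirst (x ∷ w) with D? x
  ... | yes Dx = [] , x ∷ w , refl , (λ ()) , after
    where
    after : ∀ {m} → m ∈ x ∷ w → ∃ λ d → D d × d ∈ x ∷ w × x ∷ w ⊢ d ≼ m
    after (here refl) = x , Dx , here refl , inj₁ refl
    after (there p)   = x , Dx , here refl , inj₂ (head≺ p)
  ... | no ¬Dx with cutBeforeFirst w
  ...   | u , v , refl , none , after = x ∷ u , v , refl ,
          (λ { (here refl) → ¬Dx ; (there p) → none p }) ,
          λ p → let d , Dd , d∈w , d≼m = after p in d , Dd , there d∈w , ≼-∷ d≼m

enumerates-insert : ∀ {p n} u → p < n → Enumerates (suc p) n (u ++ v) → Enumerates p n (u ++ suc p ∷ v)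
unique (enumerates-insert u p<n enum) =
  Unique-resp-↭ (↭-sym (shift _ u _))
    (All.tabulate (λ { q refl → ℕ.<-irrefl refl (proj₁ (sound enum q)) }) ∷ unique enum)
sound (enumerates-insert u p<n enum) q with ∈-resp-↭ (shift _ u _) q
... | here refl = ℕ.≤-refl , p<n
... | there q′  = ℕ.<⇒≤ (proj₁ (sound enum q′)) , proj₂ (sound enum q′)
complete (enumerates-insert {p = p} u p<n enum) {x} p<x x≤n with x ℕ.≟ suc p
... | yes refl = ∈-++⁺ʳ u (here refl)
... | no x≢    = Sublist.Any-resp-⊆ (++-⊆-∷ u) (complete enum (ℕ.≤∧≢⇒< p<x (x≢ ∘ sym)) x≤n)

runs-insert : ∀ {_≺_ _≺′_ : Rel ℕ 0ℓ} {p n} t → (∀ {i j} → i ≺ j → i ≺′ j) → Runs _≺_ t (suc p) n →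
  (∀ {m} → suc p < m → m ≤ⁿ reach t (suc p) → suc p ≺′ m) ×
  (reach t (suc p) < n → suc (reach t (suc p)) ≺′ suc p) →
  Runs _≺′_ t p n
runs-insert t f runs new p<v v≤n with ℕ.m≤n⇒m<n∨m≡n p<v
... | inj₁ p+1<v = runs-mono t f runs p+1<v v≤n
... | inj₂ refl  = new

realises-insert : ∀ {n} (J : TwinBinaryTrees n) {p} u → p < n → Realises J (suc p) (u ++ v) →
  (∀ {m} → m ≤ⁿ n → Pre J (suc p) m → m ∈ u) → (∀ {m} → m ≤ⁿ n → Post J (suc p) m → m ∈ v) →
  Realises J p (u ++ suc p ∷ v)
realises-insert {v} J {p} u p<n real pre post = record
  { enumerates = enumerates-insert u p<n (enumerates real)
  ; runsᴸ = runs-insert (left J) lift (runsᴸ real)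
      ( (λ v<m m≤L → after (post (ℕ.≤-trans m≤L (reachᴸ-≤ J p<n)) (inj₁ (v<m , m≤L))))
      , (λ L<n → before (pre L<n (inj₂ refl))))
  ; runsᴿ = runs-insert (right J) lift (runsᴿ real)
      ( (λ v<m m≤R → before (pre (ℕ.≤-trans m≤R (reachᴿ-≤ J p<n)) (inj₁ (v<m , m≤R))))
      , (λ R<n → after (post R<n (inj₂ refl))))
  }
  where
  lift : ∀ {i j} → u ++ v ⊢ i ≺ j → u ++ suc p ∷ v ⊢ i ≺ j
  lift q = ⊆-trans q (++-⊆-∷ u)
  before : ∀ {m} → m ∈ u → u ++ suc p ∷ v ⊢ m ≺ suc p
  before q = ++-≺ q (here refl)
  after : ∀ {m} → m ∈ v → u ++ suc p ∷ v ⊢ suc p ≺ m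
  after q = Sublist.++⁺ˡ u (head≺ q)

-- Simultaneous construction of the two permutations

-- A letter m that precedes v in σ only would satisfy these hypotheses when v is
-- placed as early as possible in σ and as late as possible in ν.
no-crossing : ∀ {n} (J₀ J₁ : TwinBinaryTrees n) → J₀ ⊴ J₁ → ∀ {v σ ν} → 0 < v →
  Realises J₀ v σ → Realises J₁ v ν → σ ⊑ ν →
  ∀ {d e m} → d ≤ⁿ n → e ≤ⁿ n → m ∈ σ → Pre J₀ v d → Post J₁ v e → σ ⊢ m ≼ d → ¬ ν ⊢ e ≼ m
no-crossing {n} J₀ J₁ J₀⊴J₁ {v} {σ} {ν} 0<v real₀ real₁ σ⊑ν {d} {e} {m} d≤n e≤n m∈σ pre post m≼d e≼m =
  cases (twin J₀ 0<v v<n) (twin J₁ 0<v v<n) pre post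
  where
  uσ = unique (enumerates real₀)
  uν = unique (enumerates real₁)
  v<n : v < n
  v<n = ℕ.<-≤-trans (Pre⇒< J₀ pre) d≤n
  v<m : v < m
  v<m = proj₁ (sound (enumerates real₀) m∈σ)
  L₁≤L₀ = proj₁ (J₀⊴J₁ 0<v (ℕ.<⇒≤ v<n))
  R₀≤R₁ = proj₂ (J₀⊴J₁ 0<v (ℕ.<⇒≤ v<n))

  -- Since `j` lies in the left run of `v` in `J₀`, `m` precedes `j` in `σ` unless they coincide. If
  -- `m ≤ j`, then `m` lies in this run too and stands after `d`. Otherwise the inversion of `m` and
  -- `j` passes to `ν` and puts `m` before `e`.
  via-post : ∀ {j} → v < j → j ≤ⁿ reachᴸ J₀ v → (∀ {i} → ν ⊢ i ≺ j → ν ⊢ i ≺ e) → ⊥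
  via-post {j} v<j j≤L j≼e with ℕ.<-≤-connex j m
  ... | inj₂ m≤j = ≺⇒⋠ uσ (Pre≺Post J₀ 0<v real₀ d≤n (proj₂ (sound (enumerates real₀) m∈σ)) pre
                     (inj₁ (v<m , ℕ.≤-trans m≤j j≤L))) m≼d
  ... | inj₁ j<m = ≺⇒⋠ uν (j≼e (σ⊑ν j<m (≼-≺-trans uσ m≼d
    (Pre≺Post J₀ 0<v real₀ d≤n (ℕ.≤-trans j≤L (reachᴸ-≤ J₀ (ℕ.<⇒≤ v<n))) pre (inj₁ (v<j , j≤L)))))) e≼m

  -- Here `d` lies in the right run of `v` in `J₁`, so it precedes `e` in `ν`. If `m ≤ d`, so does
  -- `m`; otherwise `m` before `d` is an inversion that passes to `ν`, and `m` again precedes `e`.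
  via-pre : d ≤ⁿ reachᴿ J₁ v → ⊥
  via-pre d≤R with ℕ.<-≤-connex d m
  ... | inj₂ m≤d = ≺⇒⋠ uν (Pre≺Post J₁ 0<v real₁ (ℕ.≤-trans m≤d d≤n) e≤n
                     (inj₁ (v<m , ℕ.≤-trans m≤d d≤R)) post) e≼m
  ... | inj₁ d<m = strict m≼d
    where
    strict : ¬ σ ⊢ m ≼ d
    strict (inj₁ m≡d) = ℕ.<⇒≢ d<m (sym m≡d)
    strict (inj₂ m≺d) = ≺⇒⋠ uν (≺-trans uν (σ⊑ν d<m m≺d)
      (Pre≺Post J₁ 0<v real₁ d≤n e≤n (inj₁ (Pre⇒< J₀ pre , d≤R)) post)) e≼m

  cases : (v < reachᴸ J₀ v × reachᴿ J₀ v ≡ v) ⊎ (reachᴸ J₀ v ≡ v × v < reachᴿ J₀ v) →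
          (v < reachᴸ J₁ v × reachᴿ J₁ v ≡ v) ⊎ (reachᴸ J₁ v ≡ v × v < reachᴿ J₁ v) →
          Pre J₀ v d → Post J₁ v e → ⊥
  cases (inj₁ _) (inj₁ (v<L₁ , _)) _ (inj₁ (v<e , e≤L₁)) = via-post v<e (ℕ.≤-trans e≤L₁ L₁≤L₀) (λ q → q)
  cases (inj₁ _) (inj₁ (v<L₁ , R₁≡v)) _ (inj₂ refl) =
    via-post (Post⇒< J₁ post) (ℕ.≤-trans (subst (λ r → suc r ≤ⁿ reachᴸ J₁ v) (sym R₁≡v) v<L₁) L₁≤L₀) (λ q → q)
  -- The witness `j` is `suc v`, which lies in the left run for `J₀` and in the right run for `J₁`,
  -- hence before `e` in `ν`.
  cases (inj₁ (v<L₀ , _)) (inj₂ (_ , v<R₁)) _ _ =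
    via-post ℕ.≤-refl v<L₀ (λ q → ≺-trans uν q
      (Pre≺Post J₁ 0<v real₁ v<n e≤n (inj₁ (ℕ.≤-refl , v<R₁)) post))
  cases (inj₂ _) (inj₂ _) (inj₁ (_ , d≤R₀)) _ = via-pre (ℕ.≤-trans d≤R₀ R₀≤R₁)
  cases (inj₂ (L₀≡v , v<R₀)) (inj₂ _) (inj₂ refl) _ =
    via-pre (ℕ.≤-trans (subst (λ r → suc r ≤ⁿ reachᴿ J₀ v) (sym L₀≡v) v<R₀) R₀≤R₁)
  cases (inj₂ (L₀≡v , _)) (inj₁ (v<L₁ , _)) _ _ =
    ℕ.<⇒≱ v<L₁ (ℕ.≤-trans L₁≤L₀ (ℕ.≤-reflexive L₀≡v))

-- The new letter is the smallest, so it forms inversions exactly with the letters before it, those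
-- of `u₀` or `u₁`.
⊑-insert : ∀ {p n} u₀ {v₀} u₁ {v₁} → p < n →
  Enumerates (suc p) n (u₀ ++ v₀) → Enumerates (suc p) n (u₁ ++ v₁) →
  u₀ ++ v₀ ⊑ u₁ ++ v₁ → (∀ {m} → m ∈ u₀ → m ∈ u₁) → u₀ ++ suc p ∷ v₀ ⊑ u₁ ++ suc p ∷ v₁
⊑-insert {p} {n} u₀ {v₀} u₁ {v₁} p<n enum₀ enum₁ old new {x} {y} x<y y≺x
  with enum₀′ ← enumerates-insert u₀ p<n enum₀ | x ℕ.≟ suc p
... | no x≢ = ⊆-trans (old x<y old-y≺x) (++-⊆-∷ u₁)
  where
  p<x : suc p < x
  p<x = ℕ.≤∧≢⇒< (proj₁ (sound enum₀′ (≺⇒∈ʳ y≺x))) (x≢ ∘ sym)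
  old-y≺x : u₀ ++ v₀ ⊢ y ≺ x
  old-y≺x with ≺-total (∈-remove u₀ (≺⇒∈ˡ y≺x) (ℕ.>⇒≢ (ℕ.<-trans p<x x<y)))
                       (∈-remove u₀ (≺⇒∈ʳ y≺x) x≢) (ℕ.>⇒≢ x<y)
  ... | inj₁ q = q
  ... | inj₂ q = contradiction (⊆-trans q (++-⊆-∷ u₀)) (≺-asym (unique enum₀′) y≺x)
... | yes refl with ∈-++⁻ u₀ (∈-remove u₀ (≺⇒∈ˡ y≺x) (ℕ.>⇒≢ x<y))
...   | inj₁ q = ++-≺ (new q) (here refl)
...   | inj₂ q = contradiction (Sublist.++⁺ˡ u₀ (head≺ q)) (≺-asym (unique enum₀′) y≺x)

-- `k` counts the letters inserted so far, so that `p` descends from `n`; the next letter to insert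
-- is `p` itself.
realise : ∀ {n} (J₀ J₁ : TwinBinaryTrees n) → J₀ ⊴ J₁ → ∀ k {p} → k + p ≡ n →
  ∃₂ λ σ ν → Realises J₀ p σ × Realises J₁ p ν × σ ⊑ ν
realise {n} J₀ J₁ _ zero refl = [] , [] , empty J₀ , empty J₁ , λ _ ()
  where
  empty : (J : TwinBinaryTrees n) → Realises J n []
  empty J = record
    { enumerates = record { unique = [] ; sound = λ () ; complete = λ n<x x≤n → contradiction x≤n (ℕ.<⇒≱ n<x) }
    ; runsᴸ = λ n<v v≤n → contradiction v≤n (ℕ.<⇒≱ n<v)
    ; runsᴿ = λ n<v v≤n → contradiction v≤n (ℕ.<⇒≱ n<v)
    }
realise {n} J₀ J₁ J₀⊴J₁ (suc k) {p} refl
  with realise J₀ J₁ J₀⊴J₁ k (ℕ.+-suc k p)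
... | σ , ν , real₀ , real₁ , σ⊑ν
  with cutAfterLast (Pre? J₀ (suc p)) σ | cutBeforeFirst (Post? J₁ (suc p)) ν
... | u₀ , v₀ , refl , before , no-pre | u₁ , v₁ , refl , no-post , after =
  u₀ ++ suc p ∷ v₀ , u₁ ++ suc p ∷ v₁ ,
  realises-insert J₀ u₀ p<n real₀ pre₀ post₀ , realises-insert J₁ u₁ p<n real₁ pre₁ post₁ ,
  ⊑-insert u₀ u₁ p<n enum₀ enum₁ σ⊑ν earlier
  where
  p<n : p < n
  p<n = s≤s (ℕ.m≤n+m p k)
  enum₀ = enumerates real₀
  enum₁ = enumerates real₁

  pre₀ : ∀ {m} → m ≤ⁿ n → Pre J₀ (suc p) m → m ∈ u₀
  pre₀ m≤n pre with ∈-++⁻ u₀ (complete enum₀ (Pre⇒< J₀ pre) m≤n)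
  ... | inj₁ q = q
  ... | inj₂ q = contradiction pre (no-pre q)

  -- The cut respects `Post` as well: a letter of `Post` before it would weakly precede a letter of
  -- `Pre`, against `Pre≺Post`.
  post₀ : ∀ {m} → m ≤ⁿ n → Post J₀ (suc p) m → m ∈ v₀
  post₀ m≤n post with ∈-++⁻ u₀ (complete enum₀ (Post⇒< J₀ post) m≤n)
  ... | inj₂ q = q
  ... | inj₁ q with d , pre , d∈σ , m≼d ← before q = contradiction m≼d
    (≺⇒⋠ (unique enum₀) (Pre≺Post J₀ (s≤s z≤n) real₀ (proj₂ (sound enum₀ d∈σ)) m≤n pre post))

  post₁ : ∀ {m} → m ≤ⁿ n → Post J₁ (suc p) m → m ∈ v₁
  post₁ m≤n post with ∈-++⁻ u₁ (complete enum₁ (Post⇒< J₁ post) m≤n)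
  ... | inj₁ q = contradiction post (no-post q)
  ... | inj₂ q = q

  pre₁ : ∀ {m} → m ≤ⁿ n → Pre J₁ (suc p) m → m ∈ u₁
  pre₁ m≤n pre with ∈-++⁻ u₁ (complete enum₁ (Pre⇒< J₁ pre) m≤n)
  ... | inj₁ q = q
  ... | inj₂ q with e , post , e∈ν , e≼m ← after q = contradiction e≼m
    (≺⇒⋠ (unique enum₁) (Pre≺Post J₁ (s≤s z≤n) real₁ m≤n (proj₂ (sound enum₁ e∈ν)) pre post))

  -- A letter before `suc p` in the first word only would come with the witnesses `d` and `e` of the
  -- two cuts, which `no-crossing` refutes.
  earlier : ∀ {m} → m ∈ u₀ → m ∈ u₁
  earlier q with lo , hi ← sound enum₀ (∈-++⁺ˡ q) with ∈-++⁻ u₁ (complete enum₁ lo hi)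
  ... | inj₁ r = r
  ... | inj₂ r with d , pre , d∈σ , m≼d ← before q | e , post , e∈ν , e≼m ← after r = contradiction e≼m
    (no-crossing J₀ J₁ J₀⊴J₁ (s≤s z≤n) real₀ real₁ σ⊑ν (proj₂ (sound enum₀ d∈σ)) (proj₂ (sound enum₁ e∈ν))
      (∈-++⁺ˡ q) pre post m≼d)

-- Permutations and the trees they determine

permutation⇒enumerates : ∀ {n} → IsPermutation n w → Enumerates 0 n w
unique   (permutation⇒enumerates p) = Unique-resp-↭ (↭-sym p)
  (Unique.applyUpTo⁺₁ suc _ λ i<j _ → ℕ.<⇒≢ (s≤s i<j))
sound    (permutation⇒enumerates p) x∈w with i , i<n , refl ← ∈-applyUpTo⁻ suc (∈-resp-↭ p x∈w) = s≤s z≤n , i<n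
complete (permutation⇒enumerates p) {suc i} _ i<n = ∈-resp-↭ (↭-sym p) (∈-applyUpTo⁺ suc i<n)

enumerates⇒permutation : ∀ {n} → Enumerates 0 n w → IsPermutation n w
enumerates⇒permutation {w} {n} enum =
  ∼bag⇒↭ (unique∧set⇒bag (unique enum) (Unique.applyUpTo⁺₁ suc n λ i<j _ → ℕ.<⇒≢ (s≤s i<j)) (mk⇔ to from))
  where
  to : ∀ {x} → x ∈ w → x ∈ applyUpTo suc n
  to x∈w with sound enum x∈w
  ... | s≤s z≤n , i<n = ∈-applyUpTo⁺ suc i<n
  from : ∀ {x} → x ∈ applyUpTo suc n → x ∈ w
  from q with i , i<n , refl ← ∈-applyUpTo⁻ suc q = complete enum (s≤s z≤n) i<n

enumerates-reverse : ∀ {n} → Enumerates 0 n w → Enumerates 0 n (reverse w)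
unique   (enumerates-reverse enum)   = Unique-resp-↭ (↭-sym (↭-reverse _)) (unique enum)
sound    (enumerates-reverse enum) q = sound enum (∈-resp-↭ (↭-reverse _) q)
complete (enumerates-reverse enum) lo hi = ∈-resp-↭ (↭-sym (↭-reverse _)) (complete enum lo hi)

bst-reverse : ∀ w → shape (foldr insert (leaf tt) w) ≡ bst (reverse w)
bst-reverse w = cong shape (sym (reverse-foldl (flip insert) (leaf tt) w))

-- If `v` reached further in `t′`, the letter `suc (reach t v)` would precede `v` in `w` and follow
-- it in `w′`, so an inversion of `w` would be lost.
⊑⇒reach-≥ : ∀ {n} t t′ → Unique w′ → w ⊑ w′ → #nodes t′ ≡ n →
  Runs (w ⊢_≺_) t 0 n → Runs (w′ ⊢_≺_) t′ 0 n → ∀ {v} → 0 < v → v ≤ⁿ n → reach t′ v ≤ⁿ reach t v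
⊑⇒reach-≥ t t′ uw′ w⊑w′ refl runs runs′ {v} 0<v v≤n = ℕ.≮⇒≥ λ e<e′ →
  ≺-asym uw′ (proj₁ (runs′ 0<v v≤n) (s≤s (v≤reach t v)) e<e′)
    (w⊑w′ (s≤s (v≤reach t v)) (proj₂ (runs 0<v v≤n) (ℕ.<-≤-trans e<e′ (reach-≤ t′ v≤n))))

-- The word fixes the tree: comparing it with itself by `⊑⇒reach-≥` in both directions yields equal
-- reaches.
bst-unique : ∀ {n} t → Enumerates 0 n w → #nodes t ≡ n → Runs (w ⊢_≺_) t 0 n → bst w ≡ t
bst-unique {w} t enum refl runs with bst-runs w (<-wellFounded _) enum
... | size , runs′ = reach-injective (bst w) t size λ v 0<v v≤n →
  let v≤ = subst (v ≤ⁿ_) size v≤n in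
  ℕ.≤-antisym (⊑⇒reach-≥ t (bst w) (unique enum) (λ _ q → q) size runs runs′ 0<v v≤)
              (⊑⇒reach-≥ (bst w) t (unique enum) (λ _ q → q) refl runs′ runs 0<v v≤)

-- Reversal exchanges inversions and noninversions, so the inclusion turns around.
reverse-⊑ : ∀ {n σ ν} → Enumerates 0 n σ → Enumerates 0 n ν → σ ⊑ ν → reverse ν ⊑ reverse σ
reverse-⊑ {ν = ν} enum₀ enum₁ σ⊑ν x<y q
  with x≺y ← Sublist.reverse⁻ {as = _ ∷ _ ∷ []} q
  with lo , hi ← sound enum₁ (≺⇒∈ˡ x≺y) | lo′ , hi′ ← sound enum₁ (≺⇒∈ʳ x≺y)
  with ≺-total (complete enum₀ lo hi) (complete enum₀ lo′ hi′) (ℕ.<⇒≢ x<y)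
... | inj₁ r = reverse-≺ r
... | inj₂ r = contradiction (σ⊑ν x<y r) (≺-asym (unique enum₁) x≺y)

P⇒realises : ∀ {n} (J : TwinBinaryTrees n) → IsPermutation n w → P w ≡ trees J →
  Enumerates 0 n w × Runs (w ⊢_≺_) (left J) 0 n × Runs (reverse w ⊢_≺_) (right J) 0 n
P⇒realises {w} {n} J perm e = enum ,
  subst (λ t → Runs (w ⊢_≺_) t 0 n) (cong proj₁ e) (proj₂ (bst-runs w (<-wellFounded n) enum)) ,
  subst (λ t → Runs (reverse w ⊢_≺_) t 0 n) (trans (sym (bst-reverse w)) (cong proj₂ e))
    (proj₂ (bst-runs (reverse w) (<-wellFounded n) (enumerates-reverse enum)))
  where enum = permutation⇒enumerates perm

realises⇒P : ∀ {n} (J : TwinBinaryTrees n) → Realises J 0 w → P w ≡ trees J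
realises⇒P {w} J real = cong₂ _,_
  (bst-unique (left J) (enumerates real) (left-size J) (runsᴸ real))
  (trans (bst-reverse w) (bst-unique (right J) (enumerates-reverse (enumerates real)) (right-size J)
    (runs-mono (right J) reverse-≺ (runsᴿ real))))

-- The two implications

≤B⇒⊴ : ∀ {n} (J₀ J₁ : TwinBinaryTrees n) → J₀ ≤B J₁ → J₀ ⊴ J₁
≤B⇒⊴ J₀ J₁ (σ , ν , permσ , permν , σ≤ν , Pσ , Pν) 0<v v≤n
  with enumσ , leftσ , rightσ ← P⇒realises J₀ permσ Pσ
     | enumν , leftν , rightν ← P⇒realises J₁ permν Pν =
  ⊑⇒reach-≥ (left J₀) (left J₁) (unique enumν) (≤P⇒⊑ σ≤ν) (left-size J₁) leftσ leftν 0<v v≤n ,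
  -- Right trees are read off reversed words, whose inversions are included the other way round;
  -- hence `J₁` comes first here.
  ⊑⇒reach-≥ (right J₁) (right J₀) (unique (enumerates-reverse enumσ))
    (reverse-⊑ enumσ enumν (≤P⇒⊑ σ≤ν)) (right-size J₀) rightν rightσ 0<v v≤n

⊴⇒≤B : ∀ {n} (J₀ J₁ : TwinBinaryTrees n) → J₀ ⊴ J₁ → J₀ ≤B J₁
⊴⇒≤B {n} J₀ J₁ J₀⊴J₁ with realise J₀ J₁ J₀⊴J₁ n (ℕ.+-identityʳ n)
... | σ , ν , real₀ , real₁ , σ⊑ν =
  σ , ν , enumerates⇒permutation enum₀ , enumerates⇒permutation enum₁ ,
  ⊑⇒≤P (unique enum₀) (unique enum₁) (same enum₀ enum₁) (same enum₁ enum₀) σ⊑ν ,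
  realises⇒P J₀ real₀ , realises⇒P J₁ real₁
  where
  enum₀ = enumerates real₀
  enum₁ = enumerates real₁
  same : ∀ {w w′ x} → Enumerates 0 n w → Enumerates 0 n w′ → x ∈ w → x ∈ w′
  same enum enum′ q with lo , hi ← sound enum q = complete enum′ lo hi

proposition5p4 : (n : ℕ) (J₀ J₁ : TwinBinaryTrees n) →
    J₀ ≤B J₁ ⇔ Pointwise _≤_ (ω (ttd J₀)) (ω (ttd J₁))
proposition5p4 n J₀ J₁ = mk⇔ (⊴⇒ω≤ J₀ J₁ ∘ ≤B⇒⊴ J₀ J₁) (⊴⇒≤B J₀ J₁ ∘ ω≤⇒⊴ J₀ J₁)
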